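{- Let $(x_k)_{k\ge0}$ be indeterminates, define $a_n=x_n$ if $n=2^k-1$ for some integer $k\ge0$ and $a_n=0$ otherwise, and let $d(n)=\det\left(a_{i+j}\right)_{i,j=0}^{n-1}$ with $d(0)=1$. For $k\ge1$ and $n\ge0$ let $\lambda_k(n)$ denote the degree of $d(n)$ in the variable $x_{2^k-1}$. Then for every $k\ge1$: $\lambda_k(n)=0$ for $0\le n\le 2^{k-1}$; $\lambda_k(2^{k-1}+i)=2i$ for $0\le i\le 2^{k-1}$; $\lambda_k(2^k+i)=2^k-2i$ for $0\le i\le 2^{k-1}$; $\lambda_k(n)=0$ for $2^k+2^{k-1}\le n\le 2^{k+1}$; and for $n>2^{k+1}$, $\lambda_k(n)=\lambda_k(n \bmod 2^{k+1})$.
   Context: The paper writes $d(n)=(-1)^{\sum_{i\ge0}\binom{\lambda_i(n)}{2}}\prod_{i\ge0}x_{2^i-1}^{\lambda_i(n)}$, so $\lambda_i(n)$ is the exponent of $x_{2^i-1}$ in $d(n)$. -}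

module Defs where

open import Algebra.Bundles.Raw using (RawRing)
import Algebra.Definitions.RawSemiring as RawSemiringDefinitions
open import Data.Fin.Base using (Fin; zero; suc; toℕ; fromℕ<; punchIn)
open import Data.Fin.Properties using (any?; toℕ-fromℕ<)
open import Data.Integer.Base as ℤ using (ℤ; 0ℤ; 1ℤ)
import Data.Integer.Properties as ℤ
open import Data.List.Base
  using (List; []; _∷_; [_]; _++_; map; foldr; filter; length; cartesianProductWith)
open import Data.List.Membership.Propositional.Properties using (∈-∃++)
open import Data.List.Relation.Binary.Permutation.Propositional
  using (_↭_; ↭-refl; ↭-sym; ↭-trans; prep)
open import Data.List.Relation.Binary.Permutation.Propositional.Properties
  using (∈-resp-↭; shift; drop-mid; ¬x∷xs↭[])
open import Data.List.Relation.Unary.Any using (here)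
open import Data.Maybe.Base using (Maybe; just; nothing)
open import Data.Nat.Base as ℕ using (ℕ; zero; suc; s≤s; z≤n)
import Data.Nat.Properties as ℕ
open import Data.List.Membership.DecPropositional ℕ._≟_ using (_∈?_)
open import Data.Product.Base using (∃; _×_; _,_; proj₁; proj₂)
open import Level using (0ℓ)
open import Relation.Binary.Definitions using (Decidable)
open import Relation.Binary.PropositionalEquality using (_≡_; refl; sym; trans; cong; subst)
open import Relation.Nullary.Decidable using (Dec; yes; no; map′; ¬?)

-- The polynomial ring ℤ[x₀, x₁, x₂, …].

-- A monomial is the list of indices of its variables, with multiplicity, and
-- is considered up to _↭_; multiplication is concatenation.
Monomial : Set
Monomial = List ℕ

exponent : ℕ → Monomial → ℕ
exponent k m = length (filter (k ℕ.≟_) m)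

infix 4 _↭?_

_↭?_ : Decidable (_↭_ {A = ℕ})
[]       ↭? []       = yes ↭-refl
[]       ↭? (y ∷ ys) = no λ p → ¬x∷xs↭[] (↭-sym p)
(x ∷ xs) ↭? ys with x ∈? ys
... | no x∉ys = no λ p → x∉ys (∈-resp-↭ p (here refl))
... | yes x∈ys with ∈-∃++ x∈ys
...   | as , bs , refl =
        map′ (λ p → ↭-trans (prep x p) (↭-sym (shift x as bs)))
             (drop-mid [] as)
             (xs ↭? as ++ bs)

-- A formal sum of terms c · m.  Several terms may share a monomial and
-- coefficients may vanish, so the polynomial denoted is the one given by coeff.
Poly : Set
Poly = List (ℤ × Monomial)

coeff : Poly → Monomial → ℤ
coeff p m = foldr ℤ._+_ 0ℤ (map proj₁ (filter (λ t → proj₂ t ↭? m) p))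

var : ℕ → Poly
var k = [ 1ℤ , [ k ] ]

polyRing : RawRing 0ℓ 0ℓ
polyRing = record
  { Carrier = Poly
  ; _≈_     = λ p q → ∀ m → coeff p m ≡ coeff q m
  ; _+_     = _++_
  ; _*_     = cartesianProductWith λ (a , m) (b , n) → a ℤ.* b , m ++ n
  ; -_      = map λ (a , m) → ℤ.- a , m
  ; 0#      = []
  ; 1#      = [ 1ℤ , [] ]
  }

maximum : List ℕ → Maybe ℕ
maximum []       = nothing
maximum (x ∷ xs) = just (foldr ℕ._⊔_ x xs)

-- The degree in the variable x_k.  Only monomials whose total coefficient is
-- nonzero count; `nothing` is the degree −∞ of the zero polynomial.
degree : ℕ → Poly → Maybe ℕ
degree k p =
  maximum (map (λ t → exponent k (proj₂ t))
               (filter (λ t → ¬? (coeff p (proj₂ t) ℤ.≟ 0ℤ)) p))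

module _ {c ℓ} (R : RawRing c ℓ) where
  open RawRing R
  open RawSemiringDefinitions rawSemiring using (sum; _^_)

  -- Laplace expansion along the first row.
  det : ∀ {n} → (Fin n → Fin n → Carrier) → Carrier
  det {zero}  M = 1#
  det {suc n} M = sum λ j →
    (- 1#) ^ toℕ j * (M zero j * det λ i k → M (suc i) (punchIn j k))

IsMersenne : ℕ → Set
IsMersenne n = ∃ λ k → n ≡ 2 ℕ.^ k ℕ.∸ 1

isMersenne? : ∀ n → Dec (IsMersenne n)
isMersenne? n = map′ (λ (i , eq) → toℕ i , eq) bound
                     (any? λ (i : Fin (suc n)) → n ℕ.≟ 2 ℕ.^ toℕ i ℕ.∸ 1)
  where
  k<2^k : ∀ k → k ℕ.< 2 ℕ.^ k
  k<2^k zero    = s≤s z≤n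
  k<2^k (suc k) = ℕ.+-mono-≤ (ℕ.m^n>0 2 k)
    (ℕ.≤-trans (k<2^k k) (ℕ.≤-reflexive (sym (ℕ.+-identityʳ (2 ℕ.^ k)))))

  bound : IsMersenne n → ∃ λ (i : Fin (suc n)) → n ≡ 2 ℕ.^ toℕ i ℕ.∸ 1
  bound (k , eq) = fromℕ< k<1+n ,
    trans eq (cong (λ j → 2 ℕ.^ j ℕ.∸ 1) (sym (toℕ-fromℕ< k<1+n)))
    where
    k<1+n : k ℕ.< suc n
    k<1+n = s≤s (subst (k ℕ.≤_) (sym eq) (ℕ.∸-monoˡ-≤ 1 (k<2^k k)))

a : ℕ → Poly
a n with isMersenne? n
... | yes _ = var n
... | no  _ = RawRing.0# polyRing

d : ℕ → Poly
d n = det polyRing {n} λ i j → a (toℕ i ℕ.+ toℕ j)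

-- λ_k(n); the name `λ` is reserved.
lam : ℕ → ℕ → Maybe ℕ
lam k n = degree (2 ℕ.^ k ℕ.∸ 1) (d n)

{-# OPTIONS --safe #-}
-- Only one permutation π of {0, …, n−1} has i + π(i) + 1 a power of two for all
-- i, so d(n) is ± a monomial.  Indeed, write n ≥ 2 as q + 2r with q + r = 2^m and
-- r ≥ 1.  For i ≥ 2^m the sum i + π(i) + 1 lies strictly between 2^m and
-- 2^(m+2), so it is 2^(m+1); the same holds for π⁻¹.  Hence π reverses the
-- block [q, q + 2r) and restricts to a permutation of the same kind on [0, q):
--
--   d(q + 2r) = ± x_{2^(m+1)−1}^{2r} · d(q).
--
-- Thus λ_k is invariant under x ↦ 2^(m+1) − x for all m ≥ k, and composing two
-- such reflections gives the period 2^(k+1).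

module Submission where

open import Defs
open import Algebra.Bundles.Raw using (RawRing)
open import Data.Fin.Base
  using (Fin; zero; suc; toℕ; punchIn; opposite; splitAt; join; _↑ˡ_; _↑ʳ_)
open import Data.Fin.Permutation
  using (Permutation′; permutation; _⟨$⟩ʳ_; _⟨$⟩ˡ_; inverseˡ; inverseʳ; flip; reverse;
         insert; remove; insert-punchIn; punchIn-permute)
  renaming (id to idₚ)
open import Data.Fin.Properties
  using (toℕ<n; toℕ-injective; toℕ-↑ˡ; toℕ-↑ʳ; ↑ˡ-injective; opposite-prop; opposite-involutive;
         splitAt-↑ˡ; splitAt-↑ʳ; splitAt⁻¹-↑ˡ; splitAt⁻¹-↑ʳ; join-splitAt; +↔⊎; punchIn-injective)
open import Data.Integer.Base as ℤ using (ℤ)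
import Data.Integer.Properties as ℤ
open import Data.List.Base using ([]; _∷_; [_]; _++_; filter; length; tabulate)
open import Data.List.Properties
  using (++-identityʳ; cartesianProductWith-zeroʳ; length-++; length-tabulate; tabulate-cong;
         filter-++; filter-accept; filter-all; filter-none)
open import Data.List.Relation.Binary.Permutation.Propositional using (↭-refl)
open import Data.List.Relation.Unary.All.Properties using (tabulate⁺)
open import Data.Maybe.Base using (just)
open import Data.Nat.Base as ℕ using (ℕ; zero; suc; _+_; _*_; _∸_; _^_; _≤_; _<_; _%_)
open import Data.Nat.Divisibility using (_∣_; divides; m%n≡0⇒n∣m; n∣m⇒m%n≡0)
open import Data.Nat.DivMod using (m%n<n; m<n⇒m%n≡m; %-distribˡ-+)
open import Data.Nat.Induction using (<-rec)
open import Data.Nat.Properties using (m^n≢0)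
import Data.Nat.Properties as ℕ
open import Data.Nat.Solver using (module +-*-Solver)
open import Data.Product.Base using (∃; _×_; _,_; proj₁; proj₂)
open import Data.Sum.Base using (_⊎_; inj₁; inj₂)
open import Data.Sum.Function.Propositional using (_⊎-↔_)
open import Function.Base using (_∘_)
open import Function.Construct.Composition using (_↔-∘_)
open import Function.Construct.Symmetry using (↔-sym)
open import Relation.Binary.PropositionalEquality
  using (_≡_; _≢_; refl; sym; trans; cong; cong₂; subst; module ≡-Reasoning)
open import Relation.Nullary.Decidable using (yes; no)
open import Relation.Nullary.Negation using (contradiction)
open +-*-Solver using (solve; con; _:=_; _:+_; _:*_)

private
  module P = RawRing polyRing
open import Algebra.Definitions.RawSemiring P.rawSemiring using (sum) renaming (_^_ to _^ᴾ_)

-- Determinants of matrices with a single transversal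

Matrix : ℕ → Set
Matrix n = Fin n → Fin n → Poly

minor : ∀ {n} → Matrix (suc n) → Fin (suc n) → Matrix n
minor M j i k = M (suc i) (punchIn j k)

sign : ℕ → Poly
sign j = (P.- P.1#) ^ᴾ j

laplaceTerm : ∀ {n} → Matrix (suc n) → Fin (suc n) → Poly
laplaceTerm M j = sign (toℕ j) P.* (M zero j P.* det polyRing (minor M j))

-- Nonvanishing is taken literally, as being different from the empty list. For the entries `a n`,
-- each `[]` or a single variable, this agrees with being nonzero in `polyRing`.
Transversal : ∀ {n} → Matrix n → Permutation′ n → Set
Transversal M π = ∀ i → M i (π ⟨$⟩ʳ i) ≢ []

sum-nonempty : ∀ {n} (t : Fin n → Poly) → sum t ≢ [] → ∃ λ j → t j ≢ []
sum-nonempty {zero}  t ne = contradiction refl ne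
sum-nonempty {suc n} t ne with t zero in eq
... | _ ∷ _ = zero , λ e → contradiction (trans (sym eq) e) λ ()
... | [] with j , h ← sum-nonempty (t ∘ suc) ne = suc j , h

sum-empty : ∀ {n} (t : Fin n → Poly) → (∀ j → t j ≡ []) → sum t ≡ []
sum-empty {zero}  t h = refl
sum-empty {suc n} t h = cong₂ _++_ (h zero) (sum-empty (t ∘ suc) (h ∘ suc))

sum-single : ∀ {n} (t : Fin n → Poly) j → (∀ i → i ≢ j → t i ≡ []) → sum t ≡ t j
sum-single t zero h =
  trans (cong (t zero ++_) (sum-empty (t ∘ suc) (λ i → h (suc i) λ ()))) (++-identityʳ _)
sum-single t (suc j) h =
  cong₂ _++_ (h zero λ ()) (sum-single (t ∘ suc) j λ i i≢j → h (suc i) λ { refl → i≢j refl })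

*-nonempty : ∀ p q → p P.* q ≢ [] → p ≢ [] × q ≢ []
*-nonempty p q ne =
  (λ { refl → ne refl }) , λ { refl → ne (cartesianProductWith-zeroʳ _ p) }

insert-transversal : ∀ {n} (M : Matrix (suc n)) j (π : Permutation′ n) →
  M zero j ≢ [] → Transversal (minor M j) π → Transversal M (insert zero j π)
insert-transversal M j π h tr zero    = h
insert-transversal M j π h tr (suc i) =
  subst (λ k → M (suc i) k ≢ []) (sym (insert-punchIn zero j π i)) (tr i)

mutual
  -- A nonempty sum has a nonempty summand and a nonempty product has nonempty factors, so some
  -- Laplace term survives, and a transversal of its minor extends to `M`.
  det-nonempty⇒transversal : ∀ {n} (M : Matrix n) → det polyRing M ≢ [] → ∃ (Transversal M)
  det-nonempty⇒transversal {zero}  M ne = idₚ , λ ()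
  det-nonempty⇒transversal {suc n} M ne
    with j , h ← sum-nonempty (laplaceTerm M) ne
    with π , _ , tr ← laplaceTerm-nonempty⇒transversal M j h = π , tr

  -- The image of row `0` is recorded so that, when the transversal is unique, all terms in other
  -- columns can be excluded.
  laplaceTerm-nonempty⇒transversal : ∀ {n} (M : Matrix (suc n)) j → laplaceTerm M j ≢ [] →
    ∃ λ π → π ⟨$⟩ʳ zero ≡ j × Transversal M π
  laplaceTerm-nonempty⇒transversal M j ne
    with h , h′ ← *-nonempty (M zero j) _ (proj₂ (*-nonempty (sign (toℕ j)) _ ne))
    with π , tr ← det-nonempty⇒transversal (minor M j) h′ =
    insert zero j π , refl , insert-transversal M j π h tr

sign-term : ∀ j → ∃ λ c → ℤ.NonZero c × sign j ≡ [ c , [] ]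
sign-term zero = ℤ.1ℤ , _ , refl
sign-term (suc j) with c , c≢0 , eq ← sign-term j =
  ℤ.-1ℤ ℤ.* c , ℤ.i*j≢0 ℤ.-1ℤ c {{_}} {{c≢0}} , cong ((P.- P.1#) P.*_) eq

-- Products of one-term formal sums are one-term formal sums, so the determinant
-- is a single term on the nose, not merely up to the equality of polyRing.
det-unique-transversal : ∀ {n} (M : Matrix n) (π : Permutation′ n) (f : Fin n → ℕ) →
  (∀ i → M i (π ⟨$⟩ʳ i) ≡ var (f i)) →
  (∀ τ → Transversal M τ → ∀ i → τ ⟨$⟩ʳ i ≡ π ⟨$⟩ʳ i) →
  ∃ λ c → ℤ.NonZero c × det polyRing M ≡ [ c , tabulate f ]
det-unique-transversal {zero}  M π f hf uniq = ℤ.1ℤ , _ , refl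
det-unique-transversal {suc n} M π f hf uniq
  with c , c≢0 , eq ← det-unique-transversal (minor M (π ⟨$⟩ʳ zero)) (remove zero π) (f ∘ suc)
    (λ i → trans (cong (M (suc i)) (sym (punchIn-permute π zero i))) (hf (suc i)))
    -- A transversal of the minor extends by `0 ↦ π 0`, so uniqueness passes from `M` to the minor.
    (λ τ tr i → punchIn-injective (π ⟨$⟩ʳ zero) _ _
      (trans (sym (insert-punchIn zero (π ⟨$⟩ʳ zero) τ i))
        (trans (uniq (insert zero (π ⟨$⟩ʳ zero) τ)
                  (insert-transversal M _ τ (subst (_≢ []) (sym (hf zero)) λ ()) tr) (suc i))
          (punchIn-permute π zero i))))
  with s , s≢0 , eqs ← sign-term (toℕ (π ⟨$⟩ʳ zero)) =
  s ℤ.* (ℤ.1ℤ ℤ.* c) ,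
  ℤ.i*j≢0 s _ {{s≢0}} {{ℤ.i*j≢0 ℤ.1ℤ c {{_}} {{c≢0}}}} ,
  trans (sum-single (laplaceTerm M) (π ⟨$⟩ʳ zero) vanish)
        (cong₂ P._*_ eqs (cong₂ P._*_ (hf zero) eq))
  where
  vanish : ∀ j → j ≢ π ⟨$⟩ʳ zero → laplaceTerm M j ≡ []
  vanish j j≢ with laplaceTerm M j in eq
  ... | [] = refl
  -- A nonempty term in column `j` would give a transversal sending `0` to `j`, against uniqueness.
  ... | _ ∷ _ with τ , τ0 , tr ← laplaceTerm-nonempty⇒transversal M j
                     (λ e → contradiction (trans (sym eq) e) λ ()) =
    contradiction (trans (sym τ0) (uniq τ tr zero)) j≢

degree-term : ∀ k c m → ℤ.NonZero c → degree k [ c , m ] ≡ just (exponent k m)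
degree-term k c m c≢0 rewrite filter-accept (λ t → proj₂ t ↭? m) {x = c , m} {xs = []} ↭-refl
  with c ℤ.+ ℤ.0ℤ ℤ.≟ ℤ.0ℤ
... | yes e = contradiction (cong ℤ.∣_∣ (trans (sym (ℤ.+-identityʳ c)) e))
              (ℕ.≢-nonZero⁻¹ ℤ.∣ c ∣ {{c≢0}})
... | no _  = refl

-- Folding a number, and the permutation built from its folds

-- The recursion n = q + 2r ↦ q; since q + r = 2^m, q is the mirror image of n
-- in 2^m.
data Folded : ℕ → Set where
  empty  : Folded 0
  single : Folded 1
  fold   : ∀ m q r → q + r ≡ 2 ^ m → Folded q → Folded (q + (r + r))

-- By induction on `n`: moving one unit from `q` to the half-length of the block raises `n` by one
-- and keeps the power of two. When `q` is `0`, `n` is `2^(m+1)`, and the next number starts over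
-- with exponent `m + 1` and half-length `1`. The witness `r` is one less than the half-length,
-- which is thereby positive.
split-fold : ∀ {n} → 2 ≤ n →
  ∃ λ m → ∃ λ q → ∃ λ r → q + suc r ≡ 2 ^ m × n ≡ q + (suc r + suc r)
split-fold {suc zero}          (ℕ.s≤s ())
split-fold {suc (suc zero)}    _ = 0 , 0 , 0 , refl , refl
split-fold {suc (suc (suc n))} _ with split-fold {suc (suc n)} (ℕ.s≤s (ℕ.s≤s ℕ.z≤n))
... | m , suc q , r , eq , eq′ =
  m , q , suc r , trans (ℕ.+-suc q (suc r)) eq ,
  trans (cong suc eq′)
    (solve 2 (λ q r → con 1 :+ (con 1 :+ q :+ (r :+ r)) := q :+ (con 1 :+ r :+ (con 1 :+ r))) refl q (suc r))
... | m , zero , r , eq , eq′ =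
  suc m , r + suc r , 0 ,
  trans (solve 1 (λ r → r :+ (con 1 :+ r) :+ con 1 := con 2 :* (con 1 :+ r)) refl r) (cong (2 *_) eq) ,
  trans (cong suc eq′)
    (solve 1 (λ r → con 1 :+ (con 1 :+ r :+ (con 1 :+ r)) := r :+ (con 1 :+ r) :+ con 2) refl r)

folded : ∀ n → Folded n
folded = <-rec Folded λ where
  zero            _   → empty
  (suc zero)      _   → single
  n@(suc (suc _)) rec → let m , q , r , eq , n≡ = split-fold {n} (ℕ.s≤s (ℕ.s≤s ℕ.z≤n)) in
    subst Folded (sym n≡) (fold m q (suc r) eq (rec (subst (q <_) (sym n≡) (ℕ.m<m+n q ℕ.z<s))))

_⊕_ : ∀ {m n} → Permutation′ m → Permutation′ n → Permutation′ (m + n)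
π ⊕ ρ = ↔-sym +↔⊎ ↔-∘ ((π ⊎-↔ ρ) ↔-∘ +↔⊎)

⊕-↑ˡ : ∀ {m n} (π : Permutation′ m) (ρ : Permutation′ n) i →
  (π ⊕ ρ) ⟨$⟩ʳ (i ↑ˡ n) ≡ (π ⟨$⟩ʳ i) ↑ˡ n
⊕-↑ˡ {m} {n} π ρ i rewrite splitAt-↑ˡ m i n = refl

⊕-↑ʳ : ∀ {m n} (π : Permutation′ m) (ρ : Permutation′ n) i →
  (π ⊕ ρ) ⟨$⟩ʳ (m ↑ʳ i) ≡ m ↑ʳ (ρ ⟨$⟩ʳ i)
⊕-↑ʳ {m} {n} π ρ i rewrite splitAt-↑ʳ m n i = refl

onSum : ∀ m {n} (P : Fin (m + n) → Set) → (∀ i → P (i ↑ˡ n)) → (∀ i → P (m ↑ʳ i)) → ∀ i → P i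
onSum m {n} P l r i = subst P (join-splitAt m n i) (lem (splitAt m i))
  where
  lem : ∀ s → P (join m n s)
  lem (inj₁ i) = l i
  lem (inj₂ i) = r i

foldPermutation : ∀ {n} → Folded n → Permutation′ n
foldPermutation empty            = idₚ
foldPermutation single           = idₚ
foldPermutation (fold m q r _ F) = foldPermutation F ⊕ reverse

-- The index of the entry that `π` selects from row `i` of the Hankel matrix `a (i + j)`.
indices : ∀ {n} → Permutation′ n → Fin n → ℕ
indices π i = toℕ i + toℕ (π ⟨$⟩ʳ i)

Supported : ∀ {n} → Permutation′ n → Set
Supported π = ∀ i → IsMersenne (indices π i)

-- The Hankel matrix is symmetric: `i + π i` does not distinguish a permutation from its inverse.
flip-supported : ∀ {n} (π : Permutation′ n) → Supported π → Supported (flip π)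
flip-supported π h i =
  subst IsMersenne (trans (cong (toℕ (π ⟨$⟩ˡ i) +_) (cong toℕ (inverseʳ π)))
                          (ℕ.+-comm (toℕ (π ⟨$⟩ˡ i)) (toℕ i)))
    (h (π ⟨$⟩ˡ i))

-- Index sums that are one less than a power of two

suc-2^∸1 : ∀ m → suc (2 ^ m ∸ 1) ≡ 2 ^ m
suc-2^∸1 m = ℕ.m+[n∸m]≡n (ℕ.m^n>0 2 m)

2^-cancel-< : ∀ {m n} → 2 ^ m < 2 ^ n → m < n
2^-cancel-< h = ℕ.≰⇒> λ n≤m → ℕ.<⇒≱ h (ℕ.^-monoʳ-≤ 2 n≤m)

2^∸1-injective : ∀ {m n} → 2 ^ m ∸ 1 ≡ 2 ^ n ∸ 1 → m ≡ n
2^∸1-injective {m} {n} eq = ℕ.≤-antisym (le eq) (le (sym eq))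
  where
  le : ∀ {m n} → 2 ^ m ∸ 1 ≡ 2 ^ n ∸ 1 → m ≤ n
  le {m} {n} eq = ℕ.≮⇒≥ λ n<m → ℕ.<⇒≢ (ℕ.^-monoʳ-< 2 (ℕ.s<s ℕ.z<s) n<m)
    (trans (sym (suc-2^∸1 n)) (trans (cong suc (sym eq)) (suc-2^∸1 m)))

reflected-sum : ∀ q r (i : Fin (r + r)) → suc (toℕ (q ↑ʳ i) + toℕ (q ↑ʳ opposite i)) ≡ 2 * (q + r)
reflected-sum q r i rewrite toℕ-↑ʳ q i | toℕ-↑ʳ q (opposite i) | opposite-prop i = begin
  suc (q + toℕ i + (q + x))
    ≡⟨ solve 3 (λ q i x → con 1 :+ (q :+ i :+ (q :+ x)) := con 2 :* q :+ (con 1 :+ i :+ x)) refl q (toℕ i) x ⟩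
  2 * q + (suc (toℕ i) + x)
    ≡⟨ cong (2 * q +_) (ℕ.m+[n∸m]≡n (toℕ<n i)) ⟩
  2 * q + (r + r)
    ≡⟨ solve 2 (λ q r → con 2 :* q :+ (r :+ r) := con 2 :* (q :+ r)) refl q r ⟩
  2 * (q + r) ∎
  where
  open ≡-Reasoning
  x = r + r ∸ suc (toℕ i)

-- The bound on `i` alone gives `2^m < i + j + 1`. Both indices are below `q + 2r`, which is at most
-- `2^(m+1)`, so `i + j + 1 < 2^(m+2)`. This leaves only the exponent `m + 1`, wherever `j` lies.
mersenne-sum : ∀ {q r i j} m → q + r ≡ 2 ^ m → q + r ≤ i → i < q + (r + r) → j < q + (r + r) →
  IsMersenne (i + j) → suc (i + j) ≡ 2 * (q + r)
mersenne-sum {q} {r} {i} {j} m eq le i< j< (l , eql) =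
  trans si+j (trans (cong (2 ^_) (ℕ.≤-antisym (ℕ.<⇒≤pred l<) m<l)) (cong (2 *_) (sym eq)))
  where
  open ℕ.≤-Reasoning
  si+j : suc (i + j) ≡ 2 ^ l
  si+j = trans (cong suc eql) (suc-2^∸1 l)
  m<l : m < l
  m<l = 2^-cancel-< (begin-strict
    2 ^ m       ≡⟨ eq ⟨
    q + r       ≤⟨ le ⟩
    i           ≤⟨ ℕ.m≤m+n i j ⟩
    i + j       <⟨ ℕ.n<1+n _ ⟩
    suc (i + j) ≡⟨ si+j ⟩
    2 ^ l ∎)
  l< : l < 2 + m
  l< = 2^-cancel-< (begin-strict
    2 ^ l       ≡⟨ si+j ⟨
    suc i + j   <⟨ ℕ.+-mono-≤-< i< j< ⟩
    q + (r + r) + (q + (r + r))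
      ≤⟨ ℕ.+-mono-≤ (ℕ.+-monoˡ-≤ (r + r) (ℕ.m≤m+n q q)) (ℕ.+-monoˡ-≤ (r + r) (ℕ.m≤m+n q q)) ⟩
    q + q + (r + r) + (q + q + (r + r))
      ≡⟨ solve 2 (λ q r → q :+ q :+ (r :+ r) :+ (q :+ q :+ (r :+ r)) := con 2 :* (con 2 :* (q :+ r)))
           refl q r ⟩
    2 * (2 * (q + r)) ≡⟨ cong (λ x → 2 * (2 * x)) eq ⟩
    2 ^ (2 + m) ∎)

indices-↑ˡ : ∀ {m n} (π : Permutation′ m) (ρ : Permutation′ n) (i : Fin m) →
  indices (π ⊕ ρ) (i ↑ˡ n) ≡ indices π i
indices-↑ˡ {m} {n} π ρ i =
  cong₂ _+_ (toℕ-↑ˡ i n) (trans (cong toℕ (⊕-↑ˡ π ρ i)) (toℕ-↑ˡ (π ⟨$⟩ʳ i) n))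

indices-reverse : ∀ {q r} m → q + r ≡ 2 ^ m → (π : Permutation′ q) (i : Fin (r + r)) →
  indices (π ⊕ reverse) (q ↑ʳ i) ≡ 2 ^ suc m ∸ 1
indices-reverse {q} {r} m eq π i = cong (_∸ 1) (begin
  suc (toℕ (q ↑ʳ i) + toℕ ((π ⊕ reverse) ⟨$⟩ʳ (q ↑ʳ i)))
    ≡⟨ cong (λ j → suc (toℕ (q ↑ʳ i) + toℕ j)) (⊕-↑ʳ π reverse i) ⟩
  suc (toℕ (q ↑ʳ i) + toℕ (q ↑ʳ opposite i)) ≡⟨ reflected-sum q r i ⟩
  2 * (q + r)                                ≡⟨ cong (2 *_) eq ⟩
  2 ^ suc m                                  ∎)
  where open ≡-Reasoning

foldPermutation-supported : ∀ {n} (F : Folded n) → Supported (foldPermutation F)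
foldPermutation-supported single zero = 0 , refl
foldPermutation-supported (fold m q r eq F) = onSum q (IsMersenne ∘ indices (foldPermutation F ⊕ reverse))
  (λ i → subst IsMersenne (sym (indices-↑ˡ (foldPermutation F) reverse i)) (foldPermutation-supported F i))
  (λ i → suc m , indices-reverse m eq (foldPermutation F) i)

-- Uniqueness of the supported permutation

module _ {q r} m (eq : q + r ≡ 2 ^ m) where

  -- Both sides have the same sum with `q + i`, namely `2^(m+1) − 1`, and cancellation identifies
  -- them.
  reflect-large : (τ : Permutation′ (q + (r + r))) → Supported τ → ∀ i → r ≤ toℕ i →
    τ ⟨$⟩ʳ (q ↑ʳ i) ≡ q ↑ʳ opposite i
  reflect-large τ h i r≤i = toℕ-injective (ℕ.+-cancelˡ-≡ (suc (toℕ (q ↑ʳ i))) _ _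
    (trans (mersenne-sum {q} {r} m eq (subst (q + r ≤_) (sym (toℕ-↑ʳ q i)) (ℕ.+-monoʳ-≤ q r≤i))
             (toℕ<n _) (toℕ<n _) (h (q ↑ʳ i)))
           (sym (reflected-sum q r i))))

  -- The lower half of the block is reached by applying the argument for the
  -- upper half to the inverse permutation.
  reflect : (τ : Permutation′ (q + (r + r))) → Supported τ → ∀ i →
    τ ⟨$⟩ʳ (q ↑ʳ i) ≡ q ↑ʳ opposite i
  reflect τ h i with r ℕ.≤? toℕ i
  ... | yes r≤i = reflect-large τ h i r≤i
  ... | no  r≰i = trans (cong (τ ⟨$⟩ʳ_) (sym flipped)) (inverseʳ τ)
    where
    flipped : τ ⟨$⟩ˡ (q ↑ʳ opposite i) ≡ q ↑ʳ i
    flipped = trans (reflect-large (flip τ) (flip-supported τ h) (opposite i)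
                       -- From `i < r`, the opposite index `2r − 1 − i` is at least `r`.
                       (subst (r ≤_) (sym (opposite-prop i)) (ℕ.m+n≤o⇒m≤o∸n r (ℕ.+-monoʳ-≤ r (ℕ.≰⇒> r≰i)))))
                    (cong (q ↑ʳ_) (opposite-involutive i))

  -- If `i < q` were sent into the block, then the inverse, which also reverses the block, would
  -- bring the image back to a point of the block instead of to `i`.
  restricts : (τ : Permutation′ (q + (r + r))) → Supported τ → ∀ i →
    ∃ λ j → τ ⟨$⟩ʳ (i ↑ˡ (r + r)) ≡ j ↑ˡ (r + r)
  restricts τ h i with splitAt q (τ ⟨$⟩ʳ (i ↑ˡ (r + r))) in e
  ... | inj₁ j = j , sym (splitAt⁻¹-↑ˡ e)
  ... | inj₂ j = contradiction absurd λ ()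
    where
    absurd : inj₁ i ≡ inj₂ (opposite j)
    absurd = begin
      inj₁ i                                          ≡⟨ splitAt-↑ˡ q i (r + r) ⟨
      splitAt q (i ↑ˡ (r + r))                        ≡⟨ cong (splitAt q) (inverseˡ τ) ⟨
      splitAt q (τ ⟨$⟩ˡ (τ ⟨$⟩ʳ (i ↑ˡ (r + r))))      ≡⟨ cong (λ x → splitAt q (τ ⟨$⟩ˡ x)) (splitAt⁻¹-↑ʳ e) ⟨
      splitAt q (τ ⟨$⟩ˡ (q ↑ʳ j))                     ≡⟨ cong (splitAt q) (reflect (flip τ) (flip-supported τ h) j) ⟩
      splitAt q (q ↑ʳ opposite j)                     ≡⟨ splitAt-↑ʳ q (r + r) (opposite j) ⟩
      inj₂ (opposite j)                               ∎
      where open ≡-Reasoning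

  restrict : (τ : Permutation′ (q + (r + r))) → Supported τ →
    ∃ λ (ρ : Permutation′ q) → ∀ i → τ ⟨$⟩ʳ (i ↑ˡ (r + r)) ≡ (ρ ⟨$⟩ʳ i) ↑ˡ (r + r)
  restrict τ h = permutation to from
      (λ j → ↑ˡ-injective (r + r) _ _ (trans (sym (to-eq (from j)))
                (trans (cong (τ ⟨$⟩ʳ_) (sym (from-eq j))) (inverseʳ τ))))
      (λ i → ↑ˡ-injective (r + r) _ _ (trans (sym (from-eq (to i)))
                (trans (cong (τ ⟨$⟩ˡ_) (sym (to-eq i))) (inverseˡ τ))))
    , to-eq
    where
    to : Fin q → Fin q
    to i = proj₁ (restricts τ h i)
    to-eq : ∀ i → τ ⟨$⟩ʳ (i ↑ˡ (r + r)) ≡ to i ↑ˡ (r + r)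
    to-eq i = proj₂ (restricts τ h i)
    -- The inverse is the restriction of `flip τ`, which is supported as well.
    from : Fin q → Fin q
    from i = proj₁ (restricts (flip τ) (flip-supported τ h) i)
    from-eq : ∀ i → τ ⟨$⟩ˡ (i ↑ˡ (r + r)) ≡ from i ↑ˡ (r + r)
    from-eq i = proj₂ (restricts (flip τ) (flip-supported τ h) i)

foldPermutation-unique : ∀ {n} (F : Folded n) (τ : Permutation′ n) → Supported τ →
  ∀ i → τ ⟨$⟩ʳ i ≡ foldPermutation F ⟨$⟩ʳ i
foldPermutation-unique single τ h zero with τ ⟨$⟩ʳ zero
... | zero = refl
foldPermutation-unique (fold m q r eq F) τ h with ρ , ρ-eq ← restrict {q} {r} m eq τ h =
  onSum q _
    (λ i → trans (ρ-eq i) (trans (cong (_↑ˡ (r + r)) (foldPermutation-unique F ρ ρ-supported i))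
                                 (sym (⊕-↑ˡ (foldPermutation F) (reverse {r + r}) i))))
    (λ i → trans (reflect {q} {r} m eq τ h i) (sym (⊕-↑ʳ (foldPermutation F) (reverse {r + r}) i)))
  where
  ρ-supported : Supported ρ
  ρ-supported i = subst IsMersenne
    (cong₂ _+_ (toℕ-↑ˡ i (r + r)) (trans (cong toℕ (ρ-eq i)) (toℕ-↑ˡ (ρ ⟨$⟩ʳ i) (r + r))))
    (h (i ↑ˡ (r + r)))

-- From the determinant to exponents in one monomial

a-mersenne : ∀ {n} → IsMersenne n → a n ≡ var n
a-mersenne {n} h with isMersenne? n
... | yes _ = refl
... | no ¬h = contradiction h ¬h

a-nonempty⇒mersenne : ∀ n → a n ≢ [] → IsMersenne n
a-nonempty⇒mersenne n ne with isMersenne? n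
... | yes h = h
... | no _  = contradiction refl ne

word : ∀ {n} → Permutation′ n → Monomial
word π = tabulate (indices π)

-- Every transversal of the Hankel matrix is supported, hence equal to `foldPermutation F`. So `d n`
-- is one term with nonzero coefficient, and its degree is read off from the word.
lam-folded : ∀ k {n} (F : Folded n) →
  lam k n ≡ just (exponent (2 ^ k ∸ 1) (word (foldPermutation F)))
lam-folded k {n} F
  with c , c≢0 , eq ← det-unique-transversal {n} (λ i j → a (toℕ i + toℕ j)) (foldPermutation F)
    (indices (foldPermutation F)) (λ i → a-mersenne (foldPermutation-supported F i))
    (λ τ tr → foldPermutation-unique F τ λ i → a-nonempty⇒mersenne _ (tr i)) =
  trans (cong (degree (2 ^ k ∸ 1)) eq)
        (degree-term (2 ^ k ∸ 1) c (word (foldPermutation F)) c≢0)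

exponent-++ : ∀ k m m′ → exponent k (m ++ m′) ≡ exponent k m + exponent k m′
exponent-++ k m m′ = trans (cong length (filter-++ (k ℕ.≟_) m m′)) (length-++ (filter (k ℕ.≟_) m))

exponent-none : ∀ k {n} (f : Fin n → ℕ) → (∀ i → k ≢ f i) → exponent k (tabulate f) ≡ 0
exponent-none k f h = cong length (filter-none (k ℕ.≟_) (tabulate⁺ h))

exponent-all : ∀ k {n} (f : Fin n → ℕ) → (∀ i → k ≡ f i) → exponent k (tabulate f) ≡ n
exponent-all k f h = trans (cong length (filter-all (k ℕ.≟_) (tabulate⁺ h))) (length-tabulate f)

tabulate-+ : ∀ m {n} (f : Fin (m + n) → ℕ) →
  tabulate f ≡ tabulate (λ i → f (i ↑ˡ n)) ++ tabulate (λ i → f (m ↑ʳ i))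
tabulate-+ zero    f = refl
tabulate-+ (suc m) f = cong (f zero ∷_) (tabulate-+ m (f ∘ suc))

exponent-fold : ∀ x m q r eq (F : Folded q) →
  exponent x (word (foldPermutation (fold m q r eq F))) ≡
  exponent x (word (foldPermutation F)) +
    exponent x (tabulate {n = r + r} λ _ → 2 ^ suc m ∸ 1)
exponent-fold x m q r eq F = begin
  exponent x (tabulate f)
    ≡⟨ cong (exponent x) (tabulate-+ q f) ⟩
  exponent x (lower ++ upper)
    ≡⟨ exponent-++ x lower upper ⟩
  exponent x lower + exponent x upper
    ≡⟨ cong₂ (λ u v → exponent x u + exponent x v)
         (tabulate-cong (indices-↑ˡ π ρ)) (tabulate-cong (indices-reverse m eq π)) ⟩
  exponent x (word π) + exponent x (tabulate {n = r + r} λ _ → 2 ^ suc m ∸ 1) ∎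
  where
  open ≡-Reasoning
  π = foldPermutation F
  ρ : Permutation′ (r + r)
  ρ = reverse
  f : Fin (q + (r + r)) → ℕ
  f = indices (π ⊕ ρ)
  lower upper : Monomial
  lower = tabulate {n = q} λ i → f (i ↑ˡ (r + r))
  upper = tabulate {n = r + r} λ i → f (q ↑ʳ i)

-- Effect of a fold on the degree

-- The reversed block contributes only the variable of index `2^(m+1) − 1`, and distinct exponents
-- give distinct Mersenne indices.
lam-fold-≢ : ∀ k m q r → q + r ≡ 2 ^ m → k ≢ suc m → lam k (q + (r + r)) ≡ lam k q
lam-fold-≢ k m q r eq k≢ = begin
  lam k (q + (r + r))         ≡⟨ lam-folded k (fold m q r eq F) ⟩
  just (exponent x (word (foldPermutation (fold m q r eq F))))
    ≡⟨ cong just (exponent-fold x m q r eq F) ⟩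
  just (e + exponent x (tabulate {n = r + r} λ _ → 2 ^ suc m ∸ 1))
    ≡⟨ cong (λ y → just (e + y))
         (exponent-none x {r + r} _ λ _ x≡ → k≢ (2^∸1-injective {k} {suc m} x≡)) ⟩
  just (e + 0)                ≡⟨ cong just (ℕ.+-identityʳ e) ⟩
  just e                      ≡⟨ lam-folded k F ⟨
  lam k q                     ∎
  where
  open ≡-Reasoning
  F = folded q
  x = 2 ^ k ∸ 1
  e = exponent x (word (foldPermutation F))

-- Row and column indices are below `2^m`, so their sum plus one stays strictly below `2^(m+1)`.
small-exponent : ∀ m {n} → n ≤ 2 ^ m → (π : Permutation′ n) →
  exponent (2 ^ suc m ∸ 1) (word π) ≡ 0
small-exponent m {n} n≤ π = exponent-none _ _ λ i e → ℕ.<⇒≢ (begin-strict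
  suc (indices π i) <⟨ ℕ.+-mono-≤-< (toℕ<n i) (toℕ<n (π ⟨$⟩ʳ i)) ⟩
  n + n             ≤⟨ ℕ.+-mono-≤ n≤ n≤ ⟩
  2 ^ m + 2 ^ m     ≡⟨ cong (2 ^ m +_) (ℕ.+-identityʳ (2 ^ m)) ⟨
  2 ^ suc m         ∎) (trans (cong suc (sym e)) (suc-2^∸1 (suc m)))
  where open ℕ.≤-Reasoning

lam-small : ∀ m n → n ≤ 2 ^ m → lam (suc m) n ≡ just 0
lam-small m n n≤ = trans (lam-folded (suc m) (folded n))
  (cong just (small-exponent m n≤ (foldPermutation (folded n))))

-- The block consists of `2r` copies of the variable, and the rest is too small to contain it
-- because `q ≤ 2^m`.
lam-fold-≡ : ∀ m q r → q + r ≡ 2 ^ m → lam (suc m) (q + (r + r)) ≡ just (2 * r)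
lam-fold-≡ m q r eq = begin
  lam (suc m) (q + (r + r))   ≡⟨ lam-folded (suc m) (fold m q r eq F) ⟩
  just (exponent x (word (foldPermutation (fold m q r eq F))))
    ≡⟨ cong just (exponent-fold x m q r eq F) ⟩
  just (exponent x (word (foldPermutation F)) + exponent x (tabulate {n = r + r} λ _ → x))
    ≡⟨ cong just (cong₂ _+_
         (small-exponent m (subst (q ≤_) eq (ℕ.m≤m+n q r)) (foldPermutation F))
         (exponent-all x {r + r} _ λ _ → refl)) ⟩
  just (r + r)                ≡⟨ cong (λ y → just (r + y)) (ℕ.+-identityʳ r) ⟨
  just (2 * r)                ∎
  where
  open ≡-Reasoning
  F = folded q
  x = 2 ^ suc m ∸ 1

-- Reflections and the values on one period

-- With `r = 2^m − x` one has `y = x + 2r`, so `y` folds to `x`. The case `x = y` is a fold with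
-- `r = 0`.
lam-mirror-≤ : ∀ k m x y → k ≢ suc m → x + y ≡ 2 ^ suc m → x ≤ y → lam k x ≡ lam k y
lam-mirror-≤ k m x y k≢ eq x≤y =
  trans (sym (lam-fold-≢ k m x r x+r≡ k≢)) (cong (lam k) (ℕ.+-cancelˡ-≡ x _ _ (begin
    x + (x + (r + r)) ≡⟨ solve 2 (λ x r → x :+ (x :+ (r :+ r)) := con 2 :* (x :+ r)) refl x r ⟩
    2 * (x + r)       ≡⟨ cong (2 *_) x+r≡ ⟩
    2 ^ suc m         ≡⟨ eq ⟨
    x + y             ∎)))
  where
  open ≡-Reasoning
  r = 2 ^ m ∸ x
  x≤ : x ≤ 2 ^ m
  x≤ = ℕ.*-cancelˡ-≤ 2 (ℕ.≤-trans
    (ℕ.+-monoʳ-≤ x (subst (_≤ y) (sym (ℕ.+-identityʳ x)) x≤y)) (ℕ.≤-reflexive eq))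
  x+r≡ : x + r ≡ 2 ^ m
  x+r≡ = ℕ.m+[n∸m]≡n x≤

lam-mirror : ∀ k m x y → k ≤ m → x + y ≡ 2 ^ suc m → lam k x ≡ lam k y
lam-mirror k m x y k≤m eq with ℕ.≤-total x y
... | inj₁ x≤y = lam-mirror-≤ k m x y (ℕ.<⇒≢ (ℕ.s≤s k≤m)) eq x≤y
... | inj₂ y≤x = sym (lam-mirror-≤ k m y x (ℕ.<⇒≢ (ℕ.s≤s k≤m)) (trans (ℕ.+-comm y x) eq) y≤x)

lam-rise : ∀ m i → i ≤ 2 ^ m → lam (suc m) (2 ^ m + i) ≡ just (2 * i)
lam-rise m i i≤ = trans
  -- `2^m + i` is `q + 2i` with `q = 2^m − i`.
  (cong (lam (suc m)) (sym (trans (sym (ℕ.+-assoc (2 ^ m ∸ i) i i)) (cong (_+ i) (ℕ.m∸n+n≡m i≤)))))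
  (lam-fold-≡ m (2 ^ m ∸ i) i (ℕ.m∸n+n≡m i≤))

-- The reflection in `2^(m+1)` carries the falling stretch to the rising one.
lam-fall : ∀ m i → i ≤ 2 ^ m → lam (suc m) (2 ^ suc m + i) ≡ just (2 ^ suc m ∸ 2 * i)
lam-fall m i i≤ = begin
  lam (suc m) (2 ^ suc m + i)
    ≡⟨ lam-mirror (suc m) (suc m) (2 ^ suc m + i) (2 ^ m + (2 ^ m ∸ i)) ℕ.≤-refl mirror ⟩
  lam (suc m) (2 ^ m + (2 ^ m ∸ i)) ≡⟨ lam-rise m (2 ^ m ∸ i) (ℕ.m∸n≤m (2 ^ m) i) ⟩
  just (2 * (2 ^ m ∸ i))            ≡⟨ cong just (ℕ.*-distribˡ-∸ 2 (2 ^ m) i) ⟩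
  just (2 ^ suc m ∸ 2 * i)          ∎
  where
  open ≡-Reasoning
  mirror : 2 ^ suc m + i + (2 ^ m + (2 ^ m ∸ i)) ≡ 2 ^ (2 + m)
  mirror = begin
    2 ^ suc m + i + (2 ^ m + (2 ^ m ∸ i))
      ≡⟨ solve 3 (λ N i x → con 2 :* N :+ i :+ (N :+ x) := con 2 :* N :+ (N :+ (i :+ x)))
           refl (2 ^ m) i (2 ^ m ∸ i) ⟩
    2 ^ suc m + (2 ^ m + (i + (2 ^ m ∸ i)))
      ≡⟨ cong (λ x → 2 ^ suc m + (2 ^ m + x)) (ℕ.m+[n∸m]≡n i≤) ⟩
    2 ^ suc m + (2 ^ m + 2 ^ m)
      ≡⟨ solve 1 (λ N → con 2 :* N :+ (N :+ N) := con 2 :* (con 2 :* N)) refl (2 ^ m) ⟩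
    2 ^ (2 + m) ∎

-- The reflection in `2^(m+1)` carries this range into `[0, 2^m]`, where the exponent vanishes.
lam-gap : ∀ m n → 2 ^ suc m + 2 ^ m ≤ n → n ≤ 2 ^ (2 + m) → lam (suc m) n ≡ just 0
lam-gap m n ≤n n≤ = trans
  (lam-mirror (suc m) (suc m) n (2 ^ (2 + m) ∸ n) ℕ.≤-refl (ℕ.m+[n∸m]≡n n≤))
  (lam-small m (2 ^ (2 + m) ∸ n) (begin
    2 ^ (2 + m) ∸ n                  ≤⟨ ℕ.∸-monoʳ-≤ (2 ^ (2 + m)) ≤n ⟩
    2 ^ (2 + m) ∸ (2 ^ suc m + 2 ^ m)
      ≡⟨ cong (_∸ (2 ^ suc m + 2 ^ m))
           (solve 1 (λ N → con 2 :* (con 2 :* N) := con 2 :* N :+ N :+ N) refl (2 ^ m)) ⟩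
    2 ^ suc m + 2 ^ m + 2 ^ m ∸ (2 ^ suc m + 2 ^ m) ≡⟨ ℕ.m+n∸m≡n (2 ^ suc m + 2 ^ m) (2 ^ m) ⟩
    2 ^ m                            ∎))
  where open ℕ.≤-Reasoning

-- Periodicity

-- The sum is below `2M`, so its quotient by `M` can only be `0` or `1`.
∣-sum-residues : ∀ {x y M} → x < M → y < M → M ∣ x + y → (x ≡ 0 × y ≡ 0) ⊎ x + y ≡ M
∣-sum-residues {x} {y} x< y< (divides 0 eq) = inj₁ (ℕ.m+n≡0⇒m≡0 x eq , ℕ.m+n≡0⇒n≡0 x eq)
∣-sum-residues {M = M} x< y< (divides 1 eq) = inj₂ (trans eq (ℕ.+-identityʳ M))
∣-sum-residues {M = M} x< y< (divides (suc (suc c)) eq) = contradiction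
  (ℕ.≤-trans (ℕ.+-monoʳ-≤ M (ℕ.m≤m+n M (c * M))) (ℕ.≤-reflexive (sym eq)))
  (ℕ.<⇒≱ (ℕ.+-mono-< x< y<))

module _ (k : ℕ) where
  private
    M = 2 ^ suc k
    instance
      M≢0 : ℕ.NonZero M
      M≢0 = m^n≢0 2 (suc k)

  -- The two residues are both `0` or add up to `2^(k+1)`; in the latter case they are mirror images
  -- in `2^k`.
  lam-residues : ∀ x y → M ∣ x + y → lam k (x % M) ≡ lam k (y % M)
  lam-residues x y M∣x+y with ∣-sum-residues (m%n<n x M) (m%n<n y M)
      (m%n≡0⇒n∣m _ M (trans (sym (%-distribˡ-+ x y M)) (n∣m⇒m%n≡0 _ M M∣x+y)))
  ... | inj₁ (x≡0 , y≡0) = cong (lam k) (trans x≡0 (sym y≡0))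
  ... | inj₂ eq          = lam-mirror k k (x % M) (y % M) ℕ.≤-refl eq

  -- Strong induction: for `n ≥ M`, the fold `q < n` is the reflection of `n` in some `2^m` with
  -- `m ≥ k`. Since `q + n = 2^(m+1)` is a multiple of `M`, the residues of `q` and `n` have the
  -- same degree too.
  lam-periodic : ∀ n → lam k n ≡ lam k (n % M)
  lam-periodic = <-rec (λ n → lam k n ≡ lam k (n % M)) go
    where
    go : ∀ n → (∀ {q} → q < n → lam k q ≡ lam k (q % M)) → lam k n ≡ lam k (n % M)
    go n rec with n ℕ.<? M
    ... | yes n<M = cong (lam k) (sym (m<n⇒m%n≡m n<M))
    ... | no  n≮M = begin
      lam k n       ≡⟨ lam-mirror k m q n k≤m q+n ⟨
      lam k q       ≡⟨ rec (subst (q <_) (sym n≡) (ℕ.m<m+n q ℕ.z<s)) ⟩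
      lam k (q % M) ≡⟨ lam-residues q n (subst (M ∣_) (sym q+n) M∣2^1+m) ⟩
      lam k (n % M) ∎
      where
      open ≡-Reasoning
      M≤n : M ≤ n
      M≤n = ℕ.≮⇒≥ n≮M
      split = split-fold (ℕ.≤-trans (ℕ.*-monoʳ-≤ 2 (ℕ.m^n>0 2 k)) M≤n)
      m = proj₁ split
      q = proj₁ (proj₂ split)
      r = suc (proj₁ (proj₂ (proj₂ split)))
      q+r : q + r ≡ 2 ^ m
      q+r = proj₁ (proj₂ (proj₂ (proj₂ split)))
      n≡ : n ≡ q + (r + r)
      n≡ = proj₂ (proj₂ (proj₂ (proj₂ split)))
      q+n : q + n ≡ 2 ^ suc m
      q+n = begin
        q + n             ≡⟨ cong (q +_) n≡ ⟩
        q + (q + (r + r)) ≡⟨ solve 2 (λ q r → q :+ (q :+ (r :+ r)) := con 2 :* (q :+ r)) refl q r ⟩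
        2 * (q + r)       ≡⟨ cong (2 *_) q+r ⟩
        2 ^ suc m         ∎
      k≤m : k ≤ m
      -- Otherwise `2^(m+1) < M ≤ n ≤ q + n = 2^(m+1)`.
      k≤m = ℕ.≮⇒≥ λ m<k → ℕ.<⇒≱ (ℕ.^-monoʳ-< 2 (ℕ.s<s ℕ.z<s) (ℕ.s≤s m<k))
        (ℕ.≤-trans M≤n (ℕ.≤-trans (ℕ.m≤n+m n q) (ℕ.≤-reflexive q+n)))
      M∣2^1+m : M ∣ 2 ^ suc m
      M∣2^1+m = divides (2 ^ (m ∸ k))
        (trans (cong (2 ^_) (sym (ℕ.m∸n+n≡m (ℕ.s≤s k≤m)))) (ℕ.^-distribˡ-+-* 2 (m ∸ k) (suc k)))

theorem4p4 : ∀ (k : ℕ) → 1 ≤ k →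
    (∀ (n : ℕ) → n ≤ 2 ^ (k ∸ 1) → lam k n ≡ just 0)
    × (∀ (i : ℕ) → i ≤ 2 ^ (k ∸ 1) → lam k (2 ^ (k ∸ 1) + i) ≡ just (2 * i))
    × (∀ (i : ℕ) → i ≤ 2 ^ (k ∸ 1) → lam k (2 ^ k + i) ≡ just (2 ^ k ∸ 2 * i))
    × (∀ (n : ℕ) → 2 ^ k + 2 ^ (k ∸ 1) ≤ n → n ≤ 2 ^ (k + 1) → lam k n ≡ just 0)
    × (∀ (n : ℕ) → 2 ^ (k + 1) < n → lam k n ≡ lam k (_%_ n (2 ^ (k + 1)) {{m^n≢0 2 (k + 1)}}))
theorem4p4 k@(suc m) _ =
  lam-small m ,
  lam-rise m ,
  lam-fall m ,
  (λ n ≤n n≤ → lam-gap m n ≤n (subst (λ j → n ≤ 2 ^ j) k+1≡ n≤)) ,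
  (λ n _ → subst (λ j → lam k n ≡ lam k (_%_ n (2 ^ j) {{m^n≢0 2 j}})) (sym k+1≡) (lam-periodic k n))
  where
  k+1≡ : k + 1 ≡ suc k
  k+1≡ = ℕ.+-comm k 1
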